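{- Let $\mathbf P$ be a cyclic CFSM protocol with communication graph $G=(N,E)$. Let $\Gamma$ be a path in the global state space of $\mathbf P$ from a global state $(S,C^0)$ to a global state $(S',C^0)$. Then for every edge $\beta\in E$ there exists a path $\Gamma'$ in the global state space such that (a) $\Gamma$ and $\Gamma'$ are locally equal, and (b) every global state $(S'',(x_\xi:\xi\in E))$ on $\Gamma'$ satisfies $\sum_{\xi\in E,\ \xi\neq\beta}|x_\xi|\le 1$.
   Context: A CFSM protocol $\mathbf P$ consists of: a finite directed graph $G=(N,E)$ (the communication graph; each edge $\xi\in E$ has a tail $-\xi\in N$ and a head $+\xi\in N$); pairwise disjoint finite sets $M_\xi$ of messages, $\xi\in E$; and for each $j\in N$ a finite state machine $F_j=(K_j,\Sigma_j,T_j,h_j)$, where $K_j$ is a finite set of states, $h_j\in K_j$ is the initial state, $\Sigma_j=\{+b: b\in M_\xi,\ j=+\xi\}\cup\{ -b: b\in M_\xi,\ j=-\xi\}$, and $T_j\subseteq K_j\times\Sigma_j\times K_j$ is the set of transitions, written $p\xrightarrow{e}q$ ($+b$ means "receive $b$", $-b$ means "send $b$"). A composite state is a vector $S=(p_j:j\in N)$ with $p_j\in K_j$; a channel content is $C=(x_\xi:\xi\in E)$ with $x_\xi\in M_\xi^*$; a global state is a pair $(S,C)$. $C^0$ denotes the channel content with all components equal to the empty word $\lambda$; the initial global state is $(S^0,C^0)$ with $S^0=(h_j:j\in N)$. Steps: with $S=(p_j)$, $S'=(q_j)$, $C=(x_\xi)$, $C'=(y_\xi)$, we write $(S,C)\vdash^{+b}(S',C')$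 if there is $\beta\in E$ with $i=+\beta$, $b\in M_\beta$, $p_i\xrightarrow{+b}q_i$ in $F_i$, $p_j=q_j$ for $j\neq i$, $x_\beta=b\,y_\beta$ and $x_\xi=y_\xi$ for $\xi\neq\beta$; and $(S,C)\vdash^{ -b}(S',C')$ if there is $\beta\in E$ with $i=-\beta$, $b\in M_\beta$, $p_i\xrightarrow{ -b}q_i$ in $F_i$, $p_j=q_j$ for $j\ne i$, $y_\beta=x_\beta b$ and $y_\xi=x_\xi$ for $\xi\neq\beta$. A global state is reachable if it can be reached from $(S^0,C^0)$ by a finite sequence of steps. The global state space is the labelled directed graph whose nodes are the reachable global states and whose edges are these steps; a path is a finite sequence of consecutive steps. For a path $\Gamma=(S_0,C_0)\vdash^{e_1}\cdots\vdash^{e_k}(S_k,C_k)$ and $i\in N$, the image of $\Gamma$ in $F_i$ is the path in the transition diagram of $F_i$, starting at the $i$-th component of $S_0$, formed (in order) by the transitions of $F_i$ performed at those steps $t$ with $e_t\in\Sigma_i$ (a path of length 0 if there are none). Two paths are locally equal if their images in $F_i$ coincide for every $i\in N$. A protocol is cyclic if its communication graph is a directed cycle. -}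

module Defs where

open import Data.Bool using (Bool; true)
open import Data.Nat using (ℕ; suc)
open import Data.Nat.DivMod using (_mod_)
open import Data.Fin using (Fin; toℕ; _≟_)
open import Data.List using (List; []; _∷_; _∷ʳ_; length; map; filter; sum; allFin)
open import Data.Product using (Σ; ∃; _×_; _,_)
open import Function.Bundles using (_↔_; Inverse)
open import Relation.Binary.Construct.Closure.ReflexiveTransitive using (Star; ε; _◅_)
open import Relation.Binary.PropositionalEquality using (_≡_; _≢_; refl)
open import Relation.Nullary using (yes; no; ¬?)

-- Finite sets are represented by Fin; parallel edges and loops are allowed.
record Digraph : Set where
  field
    nodes edges : ℕ

  N : Set
  N = Fin nodes

  E : Set
  E = Fin edges

  field
    tail head : E → N

-- A directed cycle of length suc k ≥ 1: v₀ →e₀→ v₁ →e₁→ ⋯ →v_k →e_k→ v₀,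
-- where the vᵢ (resp. eᵢ) list every node (resp. edge) exactly once.
IsDirectedCycle : Digraph → Set
IsDirectedCycle G =
  ∃ λ k → Σ (Fin (suc k) ↔ N) λ v → Σ (Fin (suc k) ↔ E) λ e →
    ∀ i → tail (Inverse.to e i) ≡ Inverse.to v i
        × head (Inverse.to e i) ≡ Inverse.to v (suc (toℕ i) mod suc k)
  where open Digraph G

record FSM (Alphabet : Set) : Set where
  field
    size : ℕ

  State : Set
  State = Fin size

  field
    -- characteristic function of the transition set T ⊆ K × Σ × K
    trans   : State → Alphabet → State → Bool
    initial : State

-- Messages carry their edge, which makes the sets M_ξ pairwise disjoint.
module Events (G : Digraph) (messages : Digraph.E G → ℕ) where
  open Digraph G

  M : E → Set
  M ξ = Fin (messages ξ)

  data Event : Set where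
    +⟨_⟩_ : (ξ : E) → M ξ → Event
    -⟨_⟩_ : (ξ : E) → M ξ → Event

  actor : Event → N
  actor (+⟨ ξ ⟩ b) = head ξ
  actor (-⟨ ξ ⟩ b) = tail ξ

  Alphabet : N → Set
  Alphabet j = ∃ λ e → actor e ≡ j

record Protocol : Set where
  field
    graph    : Digraph
    messages : Digraph.E graph → ℕ

  open Digraph graph public
  open Events graph messages public

  field
    machine : (j : N) → FSM (Alphabet j)

  K : N → Set
  K j = FSM.State (machine j)

  _—[_]→_ : {j : N} → K j → Alphabet j → K j → Set
  _—[_]→_ {j} p a q = FSM.trans (machine j) p a q ≡ true

Cyclic : Protocol → Set
Cyclic P = IsDirectedCycle (Protocol.graph P)

module GlobalStateSpace (P : Protocol) where
  open Protocol P public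

  CompositeState : Set
  CompositeState = (j : N) → K j

  ChannelContent : Set
  ChannelContent = (ξ : E) → List (M ξ)

  GlobalState : Set
  GlobalState = CompositeState × ChannelContent

  S⁰ : CompositeState
  S⁰ j = FSM.initial (machine j)

  C⁰ : ChannelContent
  C⁰ ξ = []

  -- Vectors are functions, so they are compared componentwise.
  infix 4 _≐_ _≈_
  _≐_ : {I : Set} {A : I → Set} → ((i : I) → A i) → ((i : I) → A i) → Set
  f ≐ g = ∀ i → f i ≡ g i

  _≈_ : GlobalState → GlobalState → Set
  (S , C) ≈ (S′ , C′) = S ≐ S′ × C ≐ C′

  infix 4 _⊢[_]_
  data _⊢[_]_ : GlobalState → Event → GlobalState → Set where
    receive : ∀ {S S′ C C′} (β : E) (b : M β) →
      S (head β) —[ +⟨ β ⟩ b , refl ]→ S′ (head β) →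
      (∀ j → j ≢ head β → S j ≡ S′ j) →
      C β ≡ b ∷ C′ β →
      (∀ ξ → ξ ≢ β → C ξ ≡ C′ ξ) →
      (S , C) ⊢[ +⟨ β ⟩ b ] (S′ , C′)
    send : ∀ {S S′ C C′} (β : E) (b : M β) →
      S (tail β) —[ -⟨ β ⟩ b , refl ]→ S′ (tail β) →
      (∀ j → j ≢ tail β → S j ≡ S′ j) →
      C′ β ≡ C β ∷ʳ b →
      (∀ ξ → ξ ≢ β → C′ ξ ≡ C ξ) →
      (S , C) ⊢[ -⟨ β ⟩ b ] (S′ , C′)

  Steps : GlobalState → GlobalState → Set
  Steps = Star (λ g h → ∃ λ e → g ⊢[ e ] h)

  Reachable : GlobalState → Set
  Reachable g = ∃ λ g′ → Steps (S⁰ , C⁰) g′ × g′ ≈ g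

  -- Reachability of the first node entails that of all later ones.
  record Path (g h : GlobalState) : Set where
    constructor path
    field
      reachable : Reachable g
      steps     : Steps g h

  -- A path in the transition diagram of Fᵢ: its starting state together with
  -- its sequence of transitions.
  LocalPath : N → Set
  LocalPath i = K i × List (K i × Alphabet i × K i)

  transitions : (i : N) {g h : GlobalState} → Steps g h → List (K i × Alphabet i × K i)
  transitions i ε = []
  transitions i (_◅_ {S , _} {S′ , _} (e , _) Γ) with actor e ≟ i
  ... | yes e∈Σᵢ = (S i , (e , e∈Σᵢ) , S′ i) ∷ transitions i Γ
  ... | no  _    = transitions i Γ

  image : (i : N) {g h : GlobalState} → Path g h → LocalPath i
  image i {S , _} Γ = S i , transitions i (Path.steps Γ)

  LocallyEqual : {g h g′ h′ : GlobalState} → Path g h → Path g′ h′ → Set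
  LocallyEqual Γ Γ′ = ∀ i → image i Γ ≡ image i Γ′

  visited : {g h : GlobalState} → Steps g h → List GlobalState
  visited {g} ε       = g ∷ []
  visited {g} (_ ◅ Γ) = g ∷ visited Γ

  statesOn : {g h : GlobalState} → Path g h → List GlobalState
  statesOn Γ = visited (Path.steps Γ)

  -- ∑_{ξ ≠ β} |x_ξ|
  loadOutside : E → ChannelContent → ℕ
  loadOutside β x = sum (map (λ ξ → length (x ξ)) (filter (λ ξ → ¬? (ξ ≟ β)) (allFin edges)))

{-# OPTIONS --safe #-}

-- Messages on the edges ξ ≠ β can be delivered as soon as they are sent.  Take the first
-- step of the remaining path, with all channels other than β empty.  A receive must be on β
-- and is harmless, as is a send on β.  After a send on ξ ≠ β, look at the next step of the
-- machine at the head of ξ; it exists because ξ is empty at the end.  If it is a receive, it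
-- takes the message just sent, and it can be moved right behind the send.  If it is a send,
-- it can be moved to the very front, and the argument is repeated with the edge following ξ
-- on the cycle; this stops at β at the latest.

module Submission where

open import Data.Fin using (Fin; toℕ; _≟_)
open import Data.Fin.Properties using (toℕ<n; toℕ-injective; toℕ-fromℕ<)
open import Data.List using (List; []; _∷_; _∷ʳ_; length; map; allFin)
open import Data.List.Properties using (∷-injective)
import Data.List.Relation.Unary.All as All
open import Data.List.Relation.Unary.All using (All; []; _∷_)
open import Data.List.Relation.Unary.All.Properties using (all-filter)
open import Data.List.Relation.Unary.AllPairs using ([]; _∷_)
open import Data.List.Relation.Unary.Unique.Propositional using (Unique)
open import Data.List.Relation.Unary.Unique.Propositional.Properties using (allFin⁺; filter⁺)
open import Data.Nat using (ℕ; suc; _+_; _∸_; _≤_; _<_; _≤?_; z≤n; s≤s; s≤s⁻¹)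
open import Data.Nat.DivMod using (_mod_; _%_; m<n⇒m%n≡m; n%n≡0)
open import Data.Nat.ListAction using (sum)
open import Data.Nat.Properties hiding (_≟_)
open import Data.Product using (Σ; ∃; _×_; _,_; proj₁; proj₂)
open import Data.Sum using (_⊎_; inj₁; inj₂)
open import Function.Base using (_∘_)
open import Function.Bundles using (Inverse)
open import Relation.Binary.Construct.Closure.ReflexiveTransitive using (ε; _◅_)
open import Relation.Binary.Definitions using (DecidableEquality)
open import Relation.Binary.PropositionalEquality
  using (_≡_; _≢_; refl; sym; trans; cong; cong₂; subst; subst₂; ≢-sym; module ≡-Reasoning)
open import Relation.Nullary using (Dec; yes; no; ¬?; contradiction)
open import Defs

-- Sums over lists, queues, and updates of dependent functions.

sum-map≡0 : {A : Set} (f : A → ℕ) {xs : List A} →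
  All (λ x → f x ≡ 0) xs → sum (map f xs) ≡ 0
sum-map≡0 f []       = refl
sum-map≡0 f (p ∷ ps) = cong₂ _+_ p (sum-map≡0 f ps)

-- Uniqueness lets `a` occur at most once: after it is met, every later entry differs from it and
-- contributes 0.
sum-map-supported≤ : {A : Set} → DecidableEquality A → (f : A → ℕ) (a : A) {xs : List A} →
  Unique xs → All (λ x → x ≢ a → f x ≡ 0) xs → sum (map f xs) ≤ f a
sum-map-supported≤ _≟′_ f a [] [] = z≤n
sum-map-supported≤ _≟′_ f a {x ∷ xs} (x∉xs ∷ uniq) (p ∷ ps) with x ≟′ a
... | no x≢a =
  subst (λ m → m + sum (map f xs) ≤ f a) (sym (p x≢a)) (sum-map-supported≤ _≟′_ f a uniq ps)
... | yes refl =
  ≤-reflexive (trans (cong (f x +_) (sum-map≡0 f (rest x∉xs ps))) (+-identityʳ (f x)))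
  where
  rest : ∀ {ys} → All (x ≢_) ys → All (λ y → y ≢ x → f y ≡ 0) ys → All (λ y → f y ≡ 0) ys
  rest []         []       = []
  rest (x≢y ∷ qs) (r ∷ rs) = r (≢-sym x≢y) ∷ rest qs rs

-- Since `x` is nonempty, the letter at the front is one of its own and not the appended `b`.
snoc≡cons : {A : Set} {b c : A} {z : List A} (x : List A) → x ≢ [] → x ∷ʳ b ≡ c ∷ z →
  ∃ λ y → x ≡ c ∷ y × z ≡ y ∷ʳ b
snoc≡cons []      x≢[] _    = contradiction refl x≢[]
snoc≡cons (_ ∷ x) _    refl = x , refl , refl

module _ {n : ℕ} {A : Fin n → Set} where

  update : ((i : Fin n) → A i) → (i : Fin n) → A i → (j : Fin n) → A j
  update f i a j with i ≟ j
  ... | yes refl = a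
  ... | no _     = f j

  update-at : ∀ f i a → update f i a i ≡ a
  update-at f i a with i ≟ i
  ... | yes refl = refl
  ... | no i≢i   = contradiction refl i≢i

  update-off : ∀ f i a j → j ≢ i → f j ≡ update f i a j
  update-off f i a j j≢i with i ≟ j
  ... | yes i≡j = contradiction (sym i≡j) j≢i
  ... | no _    = refl

  update-agree : ∀ f i (g : (j : Fin n) → A j) j → (j ≢ i → f j ≡ g j) → update f i (g i) j ≡ g j
  update-agree f i g j agree with i ≟ j
  ... | yes refl = refl
  ... | no i≢j   = agree (≢-sym i≢j)

-- Commuting independent steps

module Commutation (P : Protocol) where
  open GlobalStateSpace P

  channel : Event → E
  channel (+⟨ ξ ⟩ _) = ξ
  channel (-⟨ ξ ⟩ _) = ξ

  Transfer : (e : Event) → List (M (channel e)) → List (M (channel e)) → Set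
  Transfer (+⟨ _ ⟩ b) x y = x ≡ b ∷ y
  Transfer (-⟨ _ ⟩ b) x y = y ≡ x ∷ʳ b

  -- A step splits into a half on the machines and a half on the channels, which share only the
  -- event. Each half can therefore be commuted separately, and `globalStep` reassembles them.
  LocalStep : Event → CompositeState → CompositeState → Set
  LocalStep e S S′ =
    S (actor e) —[ e , refl ]→ S′ (actor e) × (∀ j → j ≢ actor e → S j ≡ S′ j)

  ChannelStep : Event → ChannelContent → ChannelContent → Set
  ChannelStep e C C′ =
    Transfer e (C (channel e)) (C′ (channel e)) × (∀ ξ → ξ ≢ channel e → C ξ ≡ C′ ξ)

  localStep : ∀ {e S S′ C C′} → (S , C) ⊢[ e ] (S′ , C′) → LocalStep e S S′
  localStep (receive _ _ t fr _ _) = t , fr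
  localStep (send _ _ t fr _ _)    = t , fr

  channelStep : ∀ {e S S′ C C′} → (S , C) ⊢[ e ] (S′ , C′) → ChannelStep e C C′
  channelStep (receive _ _ _ _ c fr) = c , fr
  channelStep (send _ _ _ _ c fr)    = c , λ ξ ξ≢ → sym (fr ξ ξ≢)

  globalStep : ∀ e {S S′ C C′} →
    LocalStep e S S′ → ChannelStep e C C′ → (S , C) ⊢[ e ] (S′ , C′)
  globalStep (+⟨ ξ ⟩ b) (t , fr) (c , fr′) = receive ξ b t fr c fr′
  globalStep (-⟨ ξ ⟩ b) (t , fr) (c , fr′) = send ξ b t fr c λ ζ ζ≢ → sym (fr′ ζ ζ≢)

  -- Vacuous for a send. A receive may overtake a step only if its channel is nonempty already
  -- before that step.
  Ready : Event → ChannelContent → Set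
  Ready e C = ∀ ξ b → e ≡ +⟨ ξ ⟩ b → C ξ ≢ []

  local-commute : ∀ e f {S T U} → actor e ≢ actor f → LocalStep e S T → LocalStep f T U →
    ∃ λ T′ → LocalStep f S T′ × LocalStep e T′ U
  local-commute e f {S} {T} {U} e≢f (te , fre) (tf , frf) =
    T′ ,
    ( subst₂ (λ p q → p —[ f , refl ]→ q) (sym (fre _ (≢-sym e≢f))) (sym T′f≡) tf
    , update-off S (actor f) (U (actor f)) ) ,
    ( subst₂ (λ p q → p —[ e , refl ]→ q)
        (update-off S (actor f) (U (actor f)) (actor e) e≢f) (frf _ e≢f) te
    , frame )
    where
    T′ : CompositeState
    T′ = update S (actor f) (U (actor f))

    T′f≡ : T′ (actor f) ≡ U (actor f)
    T′f≡ = update-at S (actor f) (U (actor f))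

    frame : ∀ j → j ≢ actor e → T′ j ≡ U j
    frame j j≢e = update-agree S (actor f) U j λ j≢f → trans (fre j j≢e) (frf j j≢f)

  channel-commute-≢ : ∀ e f {C D F} → channel e ≢ channel f →
    ChannelStep e C D → ChannelStep f D F →
    ∃ λ D′ → ChannelStep f C D′ × ChannelStep e D′ F
  channel-commute-≢ e f {C} {D} {F} e≢f (ce , fre) (cf , frf) =
    D′ ,
    ( subst₂ (Transfer f) (sym (fre _ (≢-sym e≢f))) (sym (update-at C (channel f) _)) cf
    , update-off C (channel f) (F (channel f)) ) ,
    ( subst₂ (Transfer e) (update-off C (channel f) (F (channel f)) (channel e) e≢f)
        (frf _ e≢f) ce
    , frame )
    where
    D′ : ChannelContent
    D′ = update C (channel f) (F (channel f))

    frame : ∀ ξ → ξ ≢ channel e → D′ ξ ≡ F ξ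
    frame ξ ξ≢e = update-agree C (channel f) F ξ λ ξ≢f → trans (fre ξ ξ≢e) (frf ξ ξ≢f)

  update-frame : ∀ ξ {C D F : ChannelContent} {x} →
    (∀ ζ → ζ ≢ ξ → C ζ ≡ D ζ) → (∀ ζ → ζ ≢ ξ → D ζ ≡ F ζ) →
    ∀ ζ → ζ ≢ ξ → update C ξ x ζ ≡ F ζ
  update-frame ξ {C} {x = x} fr fr′ ζ ζ≢ =
    trans (sym (update-off C ξ x ζ ζ≢)) (trans (fr ζ ζ≢) (fr′ ζ ζ≢))

  -- Two receives on one channel share its head, and two sends share its tail. Distinct actors thus
  -- leave only a send and a receive, which work at opposite ends of the queue.
  channel-commute : ∀ e f {C D F} → Dec (channel e ≡ channel f) →
    actor e ≢ actor f → Ready f C → ChannelStep e C D → ChannelStep f D F →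
    ∃ λ D′ → ChannelStep f C D′ × ChannelStep e D′ F
  channel-commute e f (no ≢-channel) _ _ ce cf = channel-commute-≢ e f ≢-channel ce cf
  channel-commute (+⟨ ξ ⟩ b) (+⟨ ξ ⟩ c) (yes refl) e≢f _ _ _ = contradiction refl e≢f
  channel-commute (-⟨ ξ ⟩ b) (-⟨ ξ ⟩ c) (yes refl) e≢f _ _ _ = contradiction refl e≢f
  channel-commute (+⟨ ξ ⟩ b) (-⟨ ξ ⟩ c) {C} {D} {F} (yes refl) _ _ (ce , fre) (cf , frf) =
    update C ξ (C ξ ∷ʳ c) ,
    (update-at C ξ _ , update-off C ξ _) ,
    (received , update-frame ξ fre frf)
    where
    open ≡-Reasoning
    received : update C ξ (C ξ ∷ʳ c) ξ ≡ b ∷ F ξ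
    received = begin
      update C ξ (C ξ ∷ʳ c) ξ ≡⟨ update-at C ξ _ ⟩
      C ξ ∷ʳ c                ≡⟨ cong (_∷ʳ c) ce ⟩
      b ∷ D ξ ∷ʳ c            ≡⟨ cong (b ∷_) (sym cf) ⟩
      b ∷ F ξ                 ∎
  channel-commute (-⟨ ξ ⟩ b) (+⟨ ξ ⟩ c) {C} {D} {F} (yes refl) _ ready (ce , fre) (cf , frf) =
    update C ξ x ,
    (trans Cξ≡ (cong (c ∷_) (sym (update-at C ξ x))) , update-off C ξ x) ,
    (trans Fξ≡ (cong (_∷ʳ b) (sym (update-at C ξ x))) , update-frame ξ fre frf)
    where
    -- `ready` rules out that the received `c` is the very `b` just sent, in which case the order
    -- would be forced.
    split = snoc≡cons (C ξ) (ready ξ c refl) (trans (sym ce) cf)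
    x   = proj₁ split
    Cξ≡ = proj₁ (proj₂ split)
    Fξ≡ = proj₂ (proj₂ split)

  -- A record rather than a function type, so that Γ and Δ can be inferred.
  infix 4 _∼_
  record _∼_ {g h : GlobalState} (Γ Δ : Steps g h) : Set where
    constructor locally
    field
      at : ∀ i → transitions i Γ ≡ transitions i Δ
  open _∼_

  ∼-trans : ∀ {g h} {Γ Δ Θ : Steps g h} → Γ ∼ Δ → Δ ∼ Θ → Γ ∼ Θ
  ∼-trans p q = locally λ i → trans (at p i) (at q i)

  ∼-cons : ∀ {g g′ h e} (s : g ⊢[ e ] g′) {Γ Δ : Steps g′ h} →
    Γ ∼ Δ → ((e , s) ◅ Γ) ∼ ((e , s) ◅ Δ)
  ∼-cons {e = e} s {Γ} {Δ} Γ∼Δ = locally cons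
    where
    cons : ∀ i → transitions i ((e , s) ◅ Γ) ≡ transitions i ((e , s) ◅ Δ)
    cons i with actor e ≟ i
    ... | yes _ = cong (_ ∷_) (at Γ∼Δ i)
    ... | no  _ = at Γ∼Δ i

  transitions-actor : ∀ {S C S′ C′ h e} (s : (S , C) ⊢[ e ] (S′ , C′)) (Γ : Steps (S′ , C′) h) →
    transitions (actor e) ((e , s) ◅ Γ)
      ≡ (S (actor e) , (e , refl) , S′ (actor e)) ∷ transitions (actor e) Γ
  transitions-actor {e = e} s Γ with actor e ≟ actor e
  ... | yes refl = refl
  ... | no e≢e   = contradiction refl e≢e

  transitions-other : ∀ {g g′ h e i} (s : g ⊢[ e ] g′) (Γ : Steps g′ h) → actor e ≢ i →
    transitions i ((e , s) ◅ Γ) ≡ transitions i Γ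
  transitions-other {e = e} {i} s Γ e≢i with actor e ≟ i
  ... | yes e≡i = contradiction e≡i e≢i
  ... | no _    = refl

  -- The step `f` leaves the state of `actor e` alone, so `e` is recorded with the same end states
  -- in both orders. The image at `actor f` is covered by the same argument with the two orders
  -- exchanged.
  ∼-swap-actor : ∀ {g h h′ k l e f}
    (s : g ⊢[ e ] h) (t : h ⊢[ f ] k) (t′ : g ⊢[ f ] h′) (s′ : h′ ⊢[ e ] k) →
    actor e ≢ actor f → (Γ : Steps k l) →
    transitions (actor e) ((e , s) ◅ (f , t) ◅ Γ)
      ≡ transitions (actor e) ((f , t′) ◅ (e , s′) ◅ Γ)
  ∼-swap-actor {S , _} {T , _} {T′ , _} {U , _} {e = e} {f} s t t′ s′ e≢f Γ = begin
    transitions i ((e , s) ◅ (f , t) ◅ Γ)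
      ≡⟨ transitions-actor s ((f , t) ◅ Γ) ⟩
    (S i , (e , refl) , T i) ∷ transitions i ((f , t) ◅ Γ)
      ≡⟨ cong ((S i , (e , refl) , T i) ∷_) (transitions-other t Γ (≢-sym e≢f)) ⟩
    (S i , (e , refl) , T i) ∷ transitions i Γ
      ≡⟨ cong₂ (λ p q → (p , (e , refl) , q) ∷ transitions i Γ)
           (proj₂ (localStep t′) i e≢f) (proj₂ (localStep t) i e≢f) ⟩
    (T′ i , (e , refl) , U i) ∷ transitions i Γ
      ≡⟨ sym (transitions-actor s′ Γ) ⟩
    transitions i ((e , s′) ◅ Γ)
      ≡⟨ sym (transitions-other t′ ((e , s′) ◅ Γ) (≢-sym e≢f)) ⟩
    transitions i ((f , t′) ◅ (e , s′) ◅ Γ) ∎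
    where
    open ≡-Reasoning
    i = actor e

  ∼-swap : ∀ {g h h′ k l e f}
    (s : g ⊢[ e ] h) (t : h ⊢[ f ] k) (t′ : g ⊢[ f ] h′) (s′ : h′ ⊢[ e ] k) →
    actor e ≢ actor f → (Γ : Steps k l) →
    ((e , s) ◅ (f , t) ◅ Γ) ∼ ((f , t′) ◅ (e , s′) ◅ Γ)
  ∼-swap {e = e} {f} s t t′ s′ e≢f Γ = locally λ i → go i (actor e ≟ i) (actor f ≟ i)
    where
    go : ∀ i → Dec (actor e ≡ i) → Dec (actor f ≡ i) →
      transitions i ((e , s) ◅ (f , t) ◅ Γ) ≡ transitions i ((f , t′) ◅ (e , s′) ◅ Γ)
    go _ (yes refl) _          = ∼-swap-actor s t t′ s′ e≢f Γ
    go _ (no _)     (yes refl) = sym (∼-swap-actor t′ s′ s t (≢-sym e≢f) Γ)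
    go i (no e≢i)   (no f≢i)   =
      trans (trans (transitions-other s _ e≢i) (transitions-other t Γ f≢i))
        (sym (trans (transitions-other t′ _ f≢i) (transitions-other s′ Γ e≢i)))

  -- Bringing the next step of a machine to the front.

  size : ∀ {g h} → Steps g h → ℕ
  size ε       = 0
  size (_ ◅ Γ) = suc (size Γ)

  record Front {g h : GlobalState} (f : Event) (Γ : Steps g h) : Set where
    constructor front
    field
      {next}    : GlobalState
      step      : g ⊢[ f ] next
      rest      : Steps next h
      equal     : Γ ∼ ((f , step) ◅ rest)
      same-size : size Γ ≡ suc (size rest)

  Front-cons : ∀ {g g′ h e f} (s : g ⊢[ e ] g′) {Γ : Steps g′ h} →
    actor e ≢ actor f → Ready f (proj₂ g) → Front f Γ → Front f ((e , s) ◅ Γ)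
  Front-cons {e = e} {f} s {Γ} e≢f ready (front {k} t Δ eq sz) =
    swapped (local-commute e f e≢f (localStep s) (localStep t))
      (channel-commute e f (channel e ≟ channel f) e≢f ready (channelStep s) (channelStep t))
    where
    swapped : (∃ λ T → LocalStep f _ T × LocalStep e T (proj₁ k)) →
      (∃ λ D → ChannelStep f _ D × ChannelStep e D (proj₂ k)) → Front f ((e , s) ◅ Γ)
    swapped (T , ft , fs) (D , gt , gs) =
      front t′ ((e , s′) ◅ Δ) (∼-trans (∼-cons s eq) (∼-swap s t t′ s′ e≢f Δ)) (cong suc sz)
      where
      t′ = globalStep f ft gt
      s′ = globalStep e fs gs

  -- Only the machine at `head ξ` can take letters off `ξ`; any other step leaves this channel alone
  -- or lengthens it.
  nonempty-preserved : ∀ {g h e ξ} → g ⊢[ e ] h → actor e ≢ head ξ →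
    proj₂ g ξ ≢ [] → proj₂ h ξ ≢ []
  nonempty-preserved {ξ = ξ} (receive ζ _ _ _ _ fr) e≢ ne with ξ ≟ ζ
  ... | yes refl = contradiction refl e≢
  ... | no ξ≢ζ   = subst (_≢ []) (fr ξ ξ≢ζ) ne
  nonempty-preserved {g} {ξ = ξ} (send ζ b _ _ c fr) e≢ ne with ξ ≟ ζ
  ... | no ξ≢ζ   = subst (_≢ []) (sym (fr ξ ξ≢ζ)) ne
  ... | yes refl = subst (_≢ []) (sym c) (snoc≢[] (proj₂ g ξ))
    where
    snoc≢[] : ∀ x → x ∷ʳ b ≢ []
    snoc≢[] []      ()
    snoc≢[] (_ ∷ _) ()

  -- To empty `ξ`, the machine at its head has to act. Its first step `f` is preceded only by steps
  -- of other machines, and `f` commutes past them: if it is a receive, injectivity of `head` puts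
  -- it on `ξ`, which stays nonempty all along.
  front-at-head : (∀ {ξ ζ} → head ξ ≡ head ζ → ξ ≡ ζ) →
    ∀ {g h} ξ (Γ : Steps g h) → proj₂ g ξ ≢ [] → proj₂ h ξ ≡ [] →
    ∃ λ f → actor f ≡ head ξ × Front f Γ
  front-at-head inj ξ ε ne empty = contradiction empty ne
  front-at-head inj {g} ξ ((e , s) ◅ Γ) ne empty with actor e ≟ head ξ
  ... | yes e≡ = e , e≡ , front s Γ (locally λ _ → refl) refl
  ... | no  e≢ with f , f≡ , fr ← front-at-head inj ξ Γ (nonempty-preserved s e≢ ne) empty =
    f , f≡ , Front-cons s (λ e≡f → e≢ (trans e≡f f≡)) ready fr
    where
    ready : Ready f (proj₂ g)
    ready ζ b refl with refl ← inj f≡ = ne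

-- The reordering

module Reordering (P : Protocol)
  (head-injective : {ξ ζ : Protocol.E P} → Protocol.head P ξ ≡ Protocol.head P ζ → ξ ≡ ζ)
  (β : Protocol.E P) (rank : Protocol.E P → ℕ)
  (rank-decreases : {ξ ζ : Protocol.E P} →
    ξ ≢ β → Protocol.tail P ζ ≡ Protocol.head P ξ → rank ζ < rank ξ)
  where
  open GlobalStateSpace P
  open Commutation P

  Quiet : ChannelContent → Set
  Quiet C = ∀ ξ → ξ ≢ β → C ξ ≡ []

  Bounded : GlobalState → Set
  Bounded (S , C) = loadOutside β C ≤ 1

  outside? : (ξ : E) → Dec (ξ ≢ β)
  outside? ξ = ¬? (ξ ≟ β)

  quiet⇒bounded : ∀ {C} → Quiet C → loadOutside β C ≤ 1
  quiet⇒bounded {C} quiet = ≤-trans (≤-reflexive (sum-map≡0 (length ∘ C)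
    (All.map (λ {ξ} ξ≢β → cong length (quiet ξ ξ≢β)) (all-filter outside? (allFin edges))))) z≤n

  singleton⇒bounded : ∀ {C} ξ {b} → C ξ ≡ b ∷ [] → (∀ ζ → ζ ≢ β → ζ ≢ ξ → C ζ ≡ []) →
    loadOutside β C ≤ 1
  singleton⇒bounded {C} ξ Cξ≡ empty = subst (loadOutside β C ≤_) (cong length Cξ≡)
    (sum-map-supported≤ _≟_ (length ∘ C) ξ (filter⁺ outside? (allFin⁺ edges))
      (All.map (λ {ζ} ζ≢β ζ≢ξ → cong length (empty ζ ζ≢β ζ≢ξ))
        (all-filter outside? (allFin edges))))

  β-step-quiet : ∀ {S S′ C C′ e} → (S , C) ⊢[ e ] (S′ , C′) → channel e ≡ β →
    Quiet C → Quiet C′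
  β-step-quiet s refl quiet ξ ξ≢β = trans (sym (proj₂ (channelStep s) ξ ξ≢β)) (quiet ξ ξ≢β)

  Schedule : ∀ {g h} → Steps g h → Set
  Schedule {g} {h} Γ = Σ (Steps g h) λ Γ′ → Γ ∼ Γ′ × All Bounded (visited Γ′)

  Schedule-cons : ∀ {g g′ h e} (s : g ⊢[ e ] g′) {Γ : Steps g′ h} →
    Bounded g → Schedule Γ → Schedule ((e , s) ◅ Γ)
  Schedule-cons s bd (Γ′ , Γ∼Γ′ , bds) = (_ , s) ◅ Γ′ , ∼-cons s Γ∼Γ′ , bd ∷ bds

  Schedule-∼ : ∀ {g h} {Γ Δ : Steps g h} → Γ ∼ Δ → Schedule Δ → Schedule Γ
  Schedule-∼ Γ∼Δ (Δ′ , Δ∼Δ′ , bds) = Δ′ , ∼-trans Γ∼Δ Δ∼Δ′ , bds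

  -- The induction is on a bound `n` for the length, since the reordered remainders are not subterms
  -- of `Γ`. The invariant is that each remainder starts with all channels other than `β` empty.
  schedule : ∀ n {g h} (Γ : Steps g h) → size Γ ≤ n →
    Quiet (proj₂ g) → proj₂ h ≐ C⁰ → Schedule Γ

  -- Together with `schedule` this recursion is lexicographic in `n` and `r`: while sends are pulled
  -- to the front one before another, `n` stays and the bound `r` on the rank drops.
  schedule-send : ∀ n r {g g′ h ξ b} (s : g ⊢[ -⟨ ξ ⟩ b ] g′) (Γ : Steps g′ h) →
    size Γ ≤ n → rank ξ < r →
    Quiet (proj₂ g) → proj₂ h ≐ C⁰ → Schedule ((-⟨ ξ ⟩ b , s) ◅ Γ)

  schedule n ε _ quiet _ = ε , locally (λ _ → refl) , quiet⇒bounded quiet ∷ []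
  schedule (suc n) ((+⟨ ξ ⟩ b , s) ◅ Γ) (s≤s sz) quiet empty with ξ ≟ β
  ... | yes ξ≡β =
    Schedule-cons s (quiet⇒bounded quiet) (schedule n Γ sz (β-step-quiet s ξ≡β quiet) empty)
  ... | no  ξ≢β with () ← trans (sym (quiet ξ ξ≢β)) (proj₁ (channelStep s))
  schedule (suc n) ((-⟨ ξ ⟩ b , s) ◅ Γ) (s≤s sz) quiet empty =
    schedule-send n _ s Γ sz ≤-refl quiet empty

  schedule-send n (suc r) {g} {g′} {ξ = ξ} {b} s Γ sz rk quiet empty with ξ ≟ β
  ... | yes ξ≡β =
    Schedule-cons s (quiet⇒bounded quiet) (schedule n Γ sz (β-step-quiet s ξ≡β quiet) empty)
  ... | no  ξ≢β = continue (front-at-head head-injective ξ Γ nonempty (empty ξ))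
    where
    content : proj₂ g′ ξ ≡ b ∷ []
    content = trans (proj₁ (channelStep s)) (cong (_∷ʳ b) (quiet ξ ξ≢β))

    nonempty : proj₂ g′ ξ ≢ []
    nonempty eq with () ← trans (sym content) eq

    others-empty : ∀ ζ → ζ ≢ β → ζ ≢ ξ → proj₂ g′ ζ ≡ []
    others-empty ζ ζ≢β ζ≢ξ = trans (sym (proj₂ (channelStep s) ζ ζ≢ξ)) (quiet ζ ζ≢β)

    tail≢ : ∀ {ζ} → tail ζ ≡ head ξ → tail ξ ≢ tail ζ
    -- Otherwise `ξ` would be a loop that follows itself on the cycle, and its rank would be below
    -- itself.
    tail≢ ζ≡ eq = <-irrefl refl (rank-decreases ξ≢β (trans eq ζ≡))

    continue : (∃ λ f → actor f ≡ head ξ × Front f Γ) → Schedule ((-⟨ ξ ⟩ b , s) ◅ Γ)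
    continue (+⟨ ζ ⟩ c , f≡ , front {k} t Δ eq sz′) with refl ← head-injective f≡ =
      Schedule-cons s (quiet⇒bounded quiet) (Schedule-∼ eq
        (Schedule-cons t (singleton⇒bounded ξ content others-empty)
          (schedule n Δ (≤-trans (n≤1+n _) (subst (_≤ n) sz′ sz)) quiet′ empty)))
      where
      quiet′ : Quiet (proj₂ k)
      quiet′ ζ ζ≢β with ζ ≟ ξ
      -- `ξ` held a single letter, so nothing is left behind the received one.
      ... | yes refl = sym (proj₂ (∷-injective (trans (sym content) (proj₁ (channelStep t)))))
      ... | no  ζ≢ξ  = trans (sym (proj₂ (channelStep t) ζ ζ≢ξ)) (others-empty ζ ζ≢β ζ≢ξ)
    -- The send `f` goes even ahead of `s`, to where everything outside `β` is still empty. As `Δ`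
    -- contains `s` again, it is as long as `Γ`; the progress is in the rank.
    continue (-⟨ ζ ⟩ c , f≡ , fr)
      with front t Δ eq sz′ ← Front-cons s (tail≢ f≡) (λ _ _ ()) fr =
      Schedule-∼ eq (schedule-send n r t Δ (subst (_≤ n) (suc-injective sz′) sz)
        (<-≤-trans (rank-decreases ξ≢β f≡) (s≤s⁻¹ rk)) quiet empty)

-- Distance along a directed cycle

module _ {k : ℕ} where

  next : Fin (suc k) → Fin (suc k)
  next i = suc (toℕ i) mod suc k

  next-cases : ∀ i →
    (toℕ i < k × toℕ (next i) ≡ suc (toℕ i)) ⊎ (toℕ i ≡ k × toℕ (next i) ≡ 0)
  next-cases i with m≤n⇒m<n∨m≡n (s≤s⁻¹ (toℕ<n i))
  ... | inj₁ i<k = inj₁ (i<k , trans (toℕ-fromℕ< _) (m<n⇒m%n≡m (s≤s i<k)))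
  ... | inj₂ i≡k = inj₂ (i≡k , trans (toℕ-fromℕ< _)
          (trans (cong (λ m → suc m % suc k) i≡k) (n%n≡0 (suc k))))

  next-injective : ∀ {i j} → next i ≡ next j → i ≡ j
  next-injective {i} {j} eq with next-cases i | next-cases j
  ... | inj₁ (_ , p)   | inj₁ (_ , q)   =
    toℕ-injective (suc-injective (trans (sym p) (trans (cong toℕ eq) q)))
  ... | inj₂ (i≡k , _) | inj₂ (j≡k , _) = toℕ-injective (trans i≡k (sym j≡k))
  ... | inj₁ (_ , p)   | inj₂ (_ , q) with () ← trans (sym p) (trans (cong toℕ eq) q)
  next-injective {i} {j} eq | inj₂ (_ , p) | inj₁ (_ , q)
    with () ← trans (sym p) (trans (cong toℕ eq) q)

  -- The number of applications of next that lead from index i to index b.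
  distance : ℕ → ℕ → ℕ
  distance b i with i ≤? b
  ... | yes _ = b ∸ i
  ... | no  _ = b + suc k ∸ i

  -- Without wrap-around both distances fall under the same branch of `distance`, and the subtrahend
  -- grows by one. With wrap-around the branch changes from `no` to `yes`. At the target itself the
  -- distance is 0 and could not drop, hence `b ≢ i`.
  distance-next : ∀ b i → b ≢ i → distance (toℕ b) (toℕ (next i)) < distance (toℕ b) (toℕ i)
  distance-next b i b≢i with next-cases i
  distance-next b i b≢i | inj₁ (i<k , eq) rewrite eq with suc (toℕ i) ≤? toℕ b | toℕ i ≤? toℕ b
  ... | yes i<b | yes _   = ∸-monoʳ-< ≤-refl i<b
  ... | yes i<b | no  i≰b = contradiction (<⇒≤ i<b) i≰b
  ... | no  i≮b | yes i≤b = contradiction (≤∧≢⇒< i≤b (b≢i ∘ sym ∘ toℕ-injective)) i≮b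
  -- The bound `suc i ≤ b + suc k` keeps the truncated subtraction from reaching 0 too early.
  ... | no  _   | no  _   = ∸-monoʳ-< ≤-refl (≤-trans (m≤n⇒m≤1+n i<k) (m≤n+m (suc k) (toℕ b)))
  distance-next b i b≢i | inj₂ (i≡k , eq) rewrite eq with toℕ i ≤? toℕ b
  ... | yes i≤b = contradiction
          -- Here `i` is the largest index, so `i ≤ b` would force `b` and `i` to be equal.
          (toℕ-injective (≤-antisym (subst (toℕ b ≤_) (sym i≡k) (s≤s⁻¹ (toℕ<n b))) i≤b)) b≢i
  -- The distance from index 0 reduces to `b`, and the one from the last index `k` is `suc b`.
  ... | no  _   = ≤-reflexive (sym (begin
      toℕ b + suc k ∸ toℕ i ≡⟨ cong (toℕ b + suc k ∸_) i≡k ⟩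
      toℕ b + suc k ∸ k     ≡⟨ cong (_∸ k) (+-suc (toℕ b) k) ⟩
      suc (toℕ b) + k ∸ k   ≡⟨ m+n∸n≡m (suc (toℕ b)) k ⟩
      suc (toℕ b)           ∎))
    where open ≡-Reasoning

-- Cyclic protocols, with edges ranked by their distance to `β`.

theorem5p2 : (P : Protocol) → Cyclic P →
    let open GlobalStateSpace P in
    (S S′ : CompositeState) (C C′ : ChannelContent) →
    C ≐ C⁰ → C′ ≐ C⁰ →
    (Γ : Path (S , C) (S′ , C′)) →
    (β : E) →
    ∃ λ g → ∃ λ h → Σ (Path g h) λ Γ′ →
    LocallyEqual Γ Γ′
    × All (λ (S″ , x) → loadOutside β x ≤ 1) (statesOn Γ′)
theorem5p2 P (k , v , e , incidence) S S′ C C′ C≐C⁰ C′≐C⁰ (GlobalStateSpace.path reachable Γ) β =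
  conclude (schedule _ Γ ≤-refl (λ ξ _ → C≐C⁰ ξ) C′≐C⁰)
  where
  open GlobalStateSpace P
  open Inverse

  index : E → Fin (suc k)
  index = from e

  index-injective : ∀ {ξ ζ} → index ξ ≡ index ζ → ξ ≡ ζ
  index-injective {ξ} {ζ} eq =
    trans (sym (strictlyInverseˡ e ξ)) (trans (cong (to e) eq) (strictlyInverseˡ e ζ))

  v-injective : ∀ {i j} → to v i ≡ to v j → i ≡ j
  v-injective {i} {j} eq =
    trans (sym (strictlyInverseʳ v i)) (trans (cong (from v) eq) (strictlyInverseʳ v j))

  tail-index : ∀ ξ → tail ξ ≡ to v (index ξ)
  tail-index ξ =
    trans (cong tail (sym (strictlyInverseˡ e ξ))) (proj₁ (incidence (index ξ)))

  head-index : ∀ ξ → head ξ ≡ to v (next (index ξ))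
  head-index ξ =
    trans (cong head (sym (strictlyInverseˡ e ξ))) (proj₂ (incidence (index ξ)))

  head-injective : ∀ {ξ ζ} → head ξ ≡ head ζ → ξ ≡ ζ
  head-injective {ξ} {ζ} eq = index-injective (next-injective (v-injective
    (trans (sym (head-index ξ)) (trans eq (head-index ζ)))))

  -- The number of edges still to be passed from `ξ` to `β` along the cycle; it bounds how often
  -- sends can be chained.
  rank : E → ℕ
  rank ξ = distance {k} (toℕ (index β)) (toℕ (index ξ))

  rank-decreases : ∀ {ξ ζ} → ξ ≢ β → tail ζ ≡ head ξ → rank ζ < rank ξ
  rank-decreases {ξ} {ζ} ξ≢β eq =
    subst (λ i → distance (toℕ (index β)) (toℕ i) < rank ξ)
      -- An edge that leaves the head of `ξ` has the index following that of `ξ`.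
      (v-injective (trans (sym (head-index ξ)) (trans (sym eq) (tail-index ζ))))
      (distance-next (index β) (index ξ) (ξ≢β ∘ sym ∘ index-injective))

  open Reordering P head-injective β rank rank-decreases

  conclude : Schedule Γ → _
  conclude (Γ′ , Γ∼Γ′ , bounded) =
    -- The reordered path starts at the same global state, so the reachability proof carries over.
    (S , C) , (S′ , C′) , path reachable Γ′ ,
    (λ i → cong (S i ,_) (Commutation._∼_.at Γ∼Γ′ i)) , bounded
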